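{- Let $N(X,Y,Z)$ be a combinational circuit with input variables $X$, internal variables $Y$ and output variables $Z$, and let $F(X,Y,Z)$ be the CNF formula specifying the functionality of $N$. Let $G\subseteq F$ be a set of clauses of $F$, let $F' = F\setminus G$ (so $F = G\wedge F'$), let $G^*$ be a set of clauses over variables in $X\cup Y\cup Z$, and let $F^* = G^*\wedge F'$. Put $T_{\mathrm{tbl}}(X,Z) = \exists Y[F]$ and $T^*_{\mathrm{tbl}}(X,Z) = \exists Y[F^*]$. Assume that for every assignment $\vec{x}$ to $X$ there is an assignment $\vec{z}$ to $Z$ with $T^*_{\mathrm{tbl}}(\vec{x},\vec{z}) = 1$. Let $Q(X,Z)$ be a formula that is a solution to the problem of taking $G^*$ out of the scope of quantifiers in $\exists Y[G^*\wedge F']$, i.e. $\exists Y[G^*\wedge F'] \equiv Q\wedge \exists Y[F']$. Then $$F\not\Rightarrow Q \quad\text{if and only if}\quad T_{\mathrm{tbl}}\not\Rightarrow T^*_{\mathrm{tbl}}.$$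
   Context: All formulas are propositional and quantifiers range over Boolean assignments. A clause is a disjunction of literals; a CNF formula is a conjunction of clauses and is identified with its set of clauses (so $F\setminus G$ denotes the conjunction of the clauses of $F$ not in $G$). $\exists Y[H]$ denotes $H$ with the variables of $Y$ existentially quantified, a predicate of the remaining variables. $A\Rightarrow B$ means that every assignment satisfying $A$ satisfies $B$; $A\equiv B$ denotes logical equivalence. The sets $X,Y,Z$ are finite and pairwise disjoint. A combinational circuit $N(X,Y,Z)$ consists of gates $g_1,\dots,g_m$ (connected acyclically), each gate computing the value of one variable of $Y\cup Z$ as a Boolean function of other variables, with every variable of $Y\cup Z$ being the output of exactly one gate. The formula $F$ specifying $N$ is $G_1\wedge\dots\wedge G_m$, where $G_i$ is a CNF formula whose satisfying assignments are exactly the assignments to the input and output variables of $g_i$ that are consistent with the function of $g_i$. In particular, for every assignment $\vec{x}$ to $X$ there is exactly one pair of assignments $(\vec{y},\vec{z})$ to $Y$ and $Z$ (the execution trace of $N$ under $\vec{x}$) such that $F(\vec{x},\vec{y},\vec{z})=1$. Partial quantifier elimination (PQE): for formulas $H_1(V,W), H_2(V,W)$, a solution to the problem of taking $H_1$ out of the scope of quantifiers in $\exists V[H_1\wedge H_2]$ is a formula $H_1^*(W)$ with $\exists V[H_1\wedge H_2]\equiv H_1^*\wedge\exists V[H_2]$. -}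

module Defs where

open import Data.Bool using (Bool; true; false; not; _∧_; _∨_; T)
import Data.Bool.Properties as Bool
open import Data.Fin using (Fin)
import Data.Fin.Properties as Fin
open import Data.List using (List; []; _∷_; map; foldr; filter; concat; tabulate)
import Data.List.Properties as List
open import Data.List.Membership.Propositional using (_∈_)
import Data.List.Membership.DecPropositional as DecMembership
open import Data.List.Relation.Binary.BagAndSetEquality using (_∼[_]_; set)
open import Data.List.Relation.Unary.All using (All)
open import Data.Nat using (ℕ)
open import Data.Product using (_×_; _,_; ∃; ∃!; proj₂)
import Data.Product.Properties as Product
open import Data.Sum using (_⊎_; inj₁; inj₂; [_,_])
import Data.Sum as Sum
import Data.Sum.Properties as Sum
open import Data.Vec using (Vec; _∷_)
import Data.Vec as Vec
import Data.Vec.Membership.Propositional as VecMembership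
open import Function.Bundles using (_⇔_)
open import Level using (0ℓ)
open import Relation.Binary.Construct.Closure.Transitive using (TransClosure)
open import Relation.Binary.Definitions using (DecidableEquality)
open import Relation.Binary.PropositionalEquality using (_≡_)
open import Relation.Nullary using (¬_)
open import Relation.Unary using (Pred; _∩_; _≐′_)

private
  variable
    V W : Set
    p q r : ℕ

Assignment : Set → Set
Assignment V = V → Bool

data Formula (V : Set) : Set where
  var     : V → Formula V
  ⊤′ ⊥′   : Formula V
  ¬′_     : Formula V → Formula V
  _∧′_    : Formula V → Formula V → Formula V
  _∨′_    : Formula V → Formula V → Formula V

infix  9 ¬′_
infixr 7 _∧′_
infixr 6 _∨′_

eval : Formula V → Assignment V → Bool
eval (var v)  σ = σ v
eval ⊤′       σ = true
eval ⊥′       σ = false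
eval (¬′ φ)   σ = not (eval φ σ)
eval (φ ∧′ ψ) σ = eval φ σ ∧ eval ψ σ
eval (φ ∨′ ψ) σ = eval φ σ ∨ eval ψ σ

⟦_⟧ : Formula V → Pred (Assignment V) 0ℓ
⟦ φ ⟧ σ = T (eval φ σ)

-- (true , v) is the literal v and (false , v) is the literal ¬v.
Literal : Set → Set
Literal V = Bool × V

Clause : Set → Set
Clause V = List (Literal V)

CNF : Set → Set
CNF V = List (Clause V)

literal : Literal V → Formula V
literal (true  , v) = var v
literal (false , v) = ¬′ var v

clause : Clause V → Formula V
clause C = foldr _∨′_ ⊥′ (map literal C)

cnf : CNF V → Formula V
cnf F = foldr _∧′_ ⊤′ (map clause F)

module Difference (_≟_ : DecidableEquality V) where
  open DecMembership (List.≡-dec (Product.≡-dec Bool._≟_ _≟_)) using (_∉?_)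

  infixl 6 _∖_

  _∖_ : CNF V → CNF V → CNF V
  F ∖ G = filter (_∉? G) F

-- ∃V[H] as a predicate of the remaining variables W.
Exists : Formula (V ⊎ W) → Pred (Assignment W) 0ℓ
Exists H w = ∃ λ v → ⟦ H ⟧ [ v , w ]

PQESolution : Formula (V ⊎ W) → Formula (V ⊎ W) → Formula W → Set
PQESolution H₁ H₂ H₁* = Exists (H₁ ∧′ H₂) ≐′ ⟦ H₁* ⟧ ∩ Exists H₂

-- The input, internal and output variables are X = Fin p, Y = Fin q and
-- Z = Fin r.  Y is the left summand because it is the set that is quantified.
Var : ℕ → ℕ → ℕ → Set
Var p q r = Fin q ⊎ (Fin p ⊎ Fin r)

_≟ⱽ_ : DecidableEquality (Var p q r)
_≟ⱽ_ = Sum.≡-dec Fin._≟_ (Sum.≡-dec Fin._≟_ Fin._≟_)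

record Gate (p q r : ℕ) : Set where
  field
    arity    : ℕ
    inputs   : Vec (Var p q r) arity
    function : Vec Bool arity → Bool
    output   : Fin q ⊎ Fin r

  outputVar : Var p q r
  outputVar = Sum.map₂ inj₂ output

  ports : List (Var p q r)
  ports = outputVar ∷ Vec.toList inputs

  Consistent : Pred (Assignment (Var p q r)) 0ℓ
  Consistent σ = σ outputVar ≡ function (Vec.map σ inputs)

record Circuit (p q r : ℕ) : Set where
  field
    size : ℕ
    gate : Fin size → Gate p q r

  _Feeds_ : Fin size → Fin size → Set
  i Feeds j = Gate.outputVar (gate i) VecMembership.∈ Gate.inputs (gate j)

  -- Acyclicity includes that no gate reads its own output.
  field
    driven  : ∀ v → ∃! _≡_ λ i → Gate.output (gate i) ≡ v
    acyclic : ∀ i → ¬ TransClosure _Feeds_ i i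

record Encodes (g : Gate p q r) (Gᵢ : CNF (Var p q r)) : Set where
  open Gate g
  field
    overPorts : All (All (λ l → proj₂ l ∈ ports)) Gᵢ
    exact     : ∀ σ → ⟦ cnf Gᵢ ⟧ σ ⇔ Consistent σ

-- Equality with G₁ ∧ … ∧ Gₘ is equality of sets of clauses.
Specifies : CNF (Var p q r) → Circuit p q r → Set
Specifies {p} {q} {r} F N =
  ∃ λ (Gs : Fin size → CNF (Var p q r)) →
    (∀ i → Encodes (gate i) (Gs i)) × F ∼[ set ] concat (tabulate Gs)
  where open Circuit N

{-# OPTIONS --safe #-}
-- Since F entails F′, on an assignment w to X ∪ Z with Ttbl w the formula
-- ∃Y[F′] holds, so the PQE equivalence reduces there to Ttbl* w ⇔ Q w.  As Q
-- does not mention Y, F ⇒ Q says the same as Ttbl ⇒ Q.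
module Submission where

open import Defs
open import Data.Bool using (T; not; _∧_; _∨_)
open import Data.Bool.Properties using (T-∧)
open import Data.Fin using (Fin)
open import Data.List using ([]; _∷_)
open import Data.List.Relation.Binary.Subset.Propositional using (_⊆_)
open import Data.List.Relation.Unary.All using (All; []; _∷_)
open import Data.List.Relation.Unary.All.Properties using (filter⁺)
open import Data.Nat using (ℕ)
open import Data.Product using (∃; _,_; proj₁; proj₂)
open import Data.Sum using (_⊎_; inj₁; inj₂; [_,_])
open import Function.Base using (_∘_)
open import Function.Bundles using (_⇔_; mk⇔; module Equivalence)
open import Relation.Binary.Definitions using (DecidableEquality)
open import Relation.Binary.PropositionalEquality
  using (_≡_; _≗_; refl; cong; cong₂; subst)
open import Relation.Unary using (_⊆′_; _⊈′_; _⊢_)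

open Equivalence using (to; from)

private
  variable
    V W : Set

-- Assignments are functions, so pointwise agreement does not by itself yield an equality to rewrite
-- with.
eval-cong : ∀ (φ : Formula V) {σ τ} → σ ≗ τ → eval φ σ ≡ eval φ τ
eval-cong (var v)  σ≗τ = σ≗τ v
eval-cong ⊤′       σ≗τ = refl
eval-cong ⊥′       σ≗τ = refl
eval-cong (¬′ φ)   σ≗τ = cong not (eval-cong φ σ≗τ)
eval-cong (φ ∧′ ψ) σ≗τ = cong₂ _∧_ (eval-cong φ σ≗τ) (eval-cong ψ σ≗τ)
eval-cong (φ ∨′ ψ) σ≗τ = cong₂ _∨_ (eval-cong φ σ≗τ) (eval-cong ψ σ≗τ)

⟦cnf⟧⇒All : ∀ (F : CNF V) {σ} → ⟦ cnf F ⟧ σ → All (λ C → ⟦ clause C ⟧ σ) F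
⟦cnf⟧⇒All []      _ = []
⟦cnf⟧⇒All (C ∷ F) p with to T-∧ p
... | c , f = c ∷ ⟦cnf⟧⇒All F f

All⇒⟦cnf⟧ : ∀ {F : CNF V} {σ} → All (λ C → ⟦ clause C ⟧ σ) F → ⟦ cnf F ⟧ σ
All⇒⟦cnf⟧ []       = _
All⇒⟦cnf⟧ (c ∷ cs) = from T-∧ (c , All⇒⟦cnf⟧ cs)

module _ (_≟_ : DecidableEquality V) where
  open Difference _≟_

  ⟦cnf⟧-∖ : ∀ (F G : CNF V) → ⟦ cnf F ⟧ ⊆′ ⟦ cnf (F ∖ G) ⟧
  -- Clause by clause, satisfaction survives filtering by any predicate.
  ⟦cnf⟧-∖ F G σ = All⇒⟦cnf⟧ ∘ filter⁺ _ ∘ ⟦cnf⟧⇒All F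

-- The witness is the part of `σ` on `V`; gluing it back to the part on `W` recovers `σ` only
-- pointwise.
Exists-intro : ∀ (H : Formula (V ⊎ W)) → ⟦ H ⟧ ⊆′ (_∘ inj₂) ⊢ Exists H
Exists-intro H σ h = σ ∘ inj₁ , subst T (eval-cong H split) h
  where
  split : σ ≗ [ σ ∘ inj₁ , σ ∘ inj₂ ]
  split (inj₁ _) = refl
  split (inj₂ _) = refl

module Entailment
  (F H₁ H₂ : Formula (V ⊎ W)) (Q : Formula W)
  (F⇒H₂ : ⟦ F ⟧ ⊆′ ⟦ H₂ ⟧) (sol : PQESolution H₁ H₂ Q)
  where

  -- The same `v` that satisfies `F` also witnesses `Exists H₂`, which is what `Q` must be joined
  -- with to recover `Exists (H₁ ∧′ H₂)`.
  entails⇒table⊆ : ⟦ F ⟧ ⊆′ (_∘ inj₂) ⊢ ⟦ Q ⟧ → Exists F ⊆′ Exists (H₁ ∧′ H₂)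
  entails⇒table⊆ F⇒Q w (v , f) =
    -- Restricting `[ v , w ]` along `inj₂` gives `w` definitionally.
    proj₂ sol w (F⇒Q [ v , w ] f , v , F⇒H₂ [ v , w ] f)

  -- Quantifying away the `V` part of `σ` loses nothing, since `Q` reads only the `W` part.
  table⊆⇒entails : Exists F ⊆′ Exists (H₁ ∧′ H₂) → ⟦ F ⟧ ⊆′ (_∘ inj₂) ⊢ ⟦ Q ⟧
  table⊆⇒entails T⊆T* σ f =
    proj₁ (proj₁ sol (σ ∘ inj₂) (T⊆T* (σ ∘ inj₂) (Exists-intro F σ f)))

proposition1 :
  ∀ (p q r : ℕ) (N : Circuit p q r) (F : CNF (Var p q r)) → Specifies F N →
  ∀ (G : CNF (Var p q r)) → G ⊆ F →
  ∀ (G* : CNF (Var p q r)) →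
  let open Difference (_≟ⱽ_ {p} {q} {r})
      F'    = F ∖ G
      F*    = cnf G* ∧′ cnf F'
      Ttbl  = Exists (cnf F)
      Ttbl* = Exists F*
  in
  (∀ (x : Assignment (Fin p)) → ∃ λ (z : Assignment (Fin r)) → Ttbl* [ x , z ]) →
  ∀ (Q : Formula (Fin p ⊎ Fin r)) → PQESolution (cnf G*) (cnf F') Q →
  (⟦ cnf F ⟧ ⊈′ (_∘ inj₂) ⊢ ⟦ Q ⟧) ⇔ (Ttbl ⊈′ Ttbl*)
proposition1 p q r N F _ G _ G* _ Q sol =
  -- Both sides are negated inclusions, so each direction is the contrapositive of one implication
  -- between the inclusions.
  mk⇔ (_∘ table⊆⇒entails) (_∘ entails⇒table⊆)
  where
  open Difference (_≟ⱽ_ {p} {q} {r})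
  open Entailment (cnf F) (cnf G*) (cnf (F ∖ G)) Q (⟦cnf⟧-∖ _≟ⱽ_ F G) sol
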